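{- For all positive integers $r$ and $k$ with $r\geq 3$, we have $m(r,k)\geq 1-\left(\frac{r-1}{r}\right)^k$.
   Context: For a graph $G$ and $S\subseteq V(G)$, $\partial S$ denotes the set of edges of $G$ with exactly one end in $S$. For a positive integer $r$, an $r$-graph is an $r$-regular graph $G$ such that $|\partial S|\geq r$ for every $S\subseteq V(G)$ of odd cardinality. A 1-factor is a perfect matching. For an $r$-graph $G$ with set $\mathcal{M}$ of 1-factors and a positive integer $k$, define $m(r,k,G)=\max_{M_1,\ldots,M_k\in\mathcal{M}} \frac{|\bigcup_{i=1}^k M_i|}{|E(G)|}$ (the $M_i$ need not be distinct), and $m(r,k)=\inf_G m(r,k,G)$, the infimum taken over all $r$-graphs $G$. -}

module Defs where

open import Data.Nat using (ℕ; _+_; _*_; _≤_; _%_)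
open import Data.Bool using (Bool; true; false; if_then_else_; _xor_)
open import Data.Fin using (Fin; _≟_)
open import Data.Fin.Subset using (Subset; ∣_∣)
open import Data.List using (List; map; allFin)
open import Data.Nat.ListAction using (sum)
open import Data.Bool.ListAction using (any)
open import Data.Vec using (lookup)
open import Data.Product using (Σ; _×_)
open import Relation.Nullary.Decidable using (⌊_⌋)
open import Relation.Binary.PropositionalEquality using (_≡_)

-- A finite multigraph (parallel edges and loops allowed a priori):
-- vertices Fin n, edges Fin m, each edge e has ends (src e) and (tgt e).
record Graph : Set where
  field
    n   : ℕ
    m   : ℕ
    src : Fin m → Fin n
    tgt : Fin m → Fin n
open Graph public

count : {k : ℕ} → (Fin k → Bool) → ℕ
count {k} p = sum (map (λ x → if p x then 1 else 0) (allFin k))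

eqℕ : {k : ℕ} → Fin k → Fin k → ℕ
eqℕ x y = if ⌊ x ≟ y ⌋ then 1 else 0

-- degree of v in the spanning subgraph with edge set F (a loop counts twice)
degIn : (G : Graph) → Subset (m G) → Fin (n G) → ℕ
degIn G F v = sum (map (λ e → if lookup F e then eqℕ (src G e) v + eqℕ (tgt G e) v else 0)
                       (allFin (m G)))

deg : (G : Graph) → Fin (n G) → ℕ
deg G v = sum (map (λ e → eqℕ (src G e) v + eqℕ (tgt G e) v) (allFin (m G)))

boundary : (G : Graph) → Subset (n G) → ℕ
boundary G S = count (λ e → lookup S (src G e) xor lookup S (tgt G e))

IsRGraph : ℕ → Graph → Set
IsRGraph r G =
  ((v : Fin (n G)) → deg G v ≡ r) ×
  ((S : Subset (n G)) → ∣ S ∣ % 2 ≡ 1 → r ≤ boundary G S)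

IsPerfectMatching : (G : Graph) → Subset (m G) → Set
IsPerfectMatching G M = (v : Fin (n G)) → degIn G M v ≡ 1

unionSize : (G : Graph) {k : ℕ} → (Fin k → Subset (m G)) → ℕ
unionSize G {k} Ms = count (λ e → any (λ i → lookup (Ms i) e) (allFin k))

{-# OPTIONS --safe #-}
module Submission where

-- If every F ⊆ E(G) admits a perfect matching M with r |M ∩ F| ≥ |F|, then choosing the matchings greedily
-- shrinks the set of uncovered edges by a factor (r-1)/r each time. Adding a large constant to the weights
-- reduces this to Edmonds' theorem that 1/r lies in the matching polytope: for all edge weights w some
-- matching M has r w(M) ≥ w(E). The argument is Schrijver's, by induction on w(E). If some vertex u is covered
-- by every maximum-weight matching, lower w by 1 on the edges at u. Otherwise lower all positive weights by 1,
-- and among the matchings good for the lowered weights take one, N, of maximum w-weight. "No such N misses both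
-- u and v" is an equivalence relation, so N is near-perfect on every class, and every positive edge lies in a
-- class K; a class carries at most r ⌊|K|/2⌋ edges because odd cuts have at least r edges.

open import Defs
import Algebra.Properties.Semiring.Sum as SemiringSum
open import Data.Bool using (Bool; true; false; if_then_else_; _∧_; _∨_; not; _xor_)
open import Data.Bool.ListAction using (any; or)
open import Data.Empty using (⊥-elim)
open import Data.Fin using (Fin; zero; suc; _≟_)
open import Data.Fin.Properties using (all?; ∀-cons; ¬∀⟶∃¬)
open import Data.Fin.Subset using (Subset; ∣_∣) renaming (⊥ to ⊥ˢ)
open import Data.Fin.Subset.Properties using (anySubset?)
open import Data.List using (map; tabulate; allFin)
open import Data.List.Properties using (map-tabulate)
open import Data.Nat using (ℕ; zero; suc; _+_; _*_; _∸_; _^_; _%_; _≤_; _<_; z≤n; s≤s; _≤?_; _⊓_; >-nonZero) renaming (_≟_ to _≟ℕ_)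
open import Data.Nat.DivMod using ([m+kn]%n≡m%n)
open import Data.Nat.ListAction using (sum)
open import Data.Nat.Properties hiding (_≟_)
open import Data.Nat.Tactic.RingSolver using (solve-∀)
open import Data.Product using (Σ; ∃; _×_; _,_; proj₁; proj₂)
open import Data.Sum using (_⊎_; inj₁; inj₂; [_,_]′) renaming (map to ⊎-map)
open import Data.Vec using ([]; _∷_; lookup)
import Data.Vec as Vec
open import Data.Vec.Functional using () renaming (_∷_ to _∷ᶠ_)
open import Data.Vec.Properties using (lookup∘tabulate; lookup-replicate)
open import Function using (_∘_; id)
open import Level using (0ℓ)
open import Relation.Binary using (Rel; IsEquivalence)
open import Relation.Binary.PropositionalEquality using (_≡_; _≢_; refl; sym; trans; cong; cong₂; subst; subst₂; module ≡-Reasoning)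
open import Relation.Nullary using (Dec; yes; no; ¬_)
open import Relation.Nullary.Decidable using (⌊_⌋; ¬?; _×-dec_; _⊎-dec_; decidable-stable)
open import Relation.Unary using (Decidable)

-- Finite sums and weights of subsets.

private variable
  p q : ℕ

ind : Bool → ℕ
ind b = if b then 1 else 0

ind-* : ∀ b x → (if b then x else 0) ≡ ind b * x
ind-* true  x = sym (+-identityʳ x)
ind-* false x = refl

ind≤1 : ∀ b → ind b ≤ 1
ind≤1 true  = s≤s z≤n
ind≤1 false = z≤n

private module Sum = SemiringSum +-*-semiring

-- Opacity of ∑ and wt keeps their arguments inferable.
opaque
  ∑ : (Fin p → ℕ) → ℕ
  ∑ = Sum.sum

  ∑-cong : {f g : Fin p → ℕ} → (∀ i → f i ≡ g i) → ∑ f ≡ ∑ g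
  ∑-cong = Sum.sum-cong-≗

  ∑-+ : (f g : Fin p → ℕ) → ∑ (λ i → f i + g i) ≡ ∑ f + ∑ g
  ∑-+ = Sum.∑-distrib-+

  ∑-comm : (f : Fin p → Fin q → ℕ) → ∑ (λ i → ∑ (f i)) ≡ ∑ (λ j → ∑ (λ i → f i j))
  ∑-comm = Sum.∑-comm

  *-∑ : (c : ℕ) (f : Fin p → ℕ) → c * ∑ f ≡ ∑ (λ i → c * f i)
  *-∑ = Sum.*-distribˡ-sum

  ∑-mono : {f g : Fin p → ℕ} → (∀ i → f i ≤ g i) → ∑ f ≤ ∑ g
  ∑-mono {zero}  h = z≤n
  ∑-mono {suc p} h = +-mono-≤ (h zero) (∑-mono (h ∘ suc))

  ∑-zero : {f : Fin p → ℕ} → (∀ i → f i ≡ 0) → ∑ f ≡ 0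
  ∑-zero {p} h = trans (Sum.sum-cong-≗ h) (Sum.sum-replicate-zero p)

  term≤∑ : (f : Fin p → ℕ) (i : Fin p) → f i ≤ ∑ f
  term≤∑ f zero    = m≤m+n _ _
  term≤∑ f (suc i) = ≤-trans (term≤∑ (f ∘ suc) i) (m≤n+m _ (f zero))

  ∑-single : (f : Fin p → ℕ) (i : Fin p) → (∀ j → j ≢ i → f j ≡ 0) → ∑ f ≡ f i
  ∑-single f zero    h = trans (cong (f zero +_) (∑-zero (λ j → h (suc j) (λ ())))) (+-identityʳ _)
  ∑-single f (suc i) h rewrite h zero (λ ()) =
    ∑-single (f ∘ suc) i (λ j j≢i → h (suc j) (λ { refl → j≢i refl }))

  ∑-const : ∀ p c → ∑ {p} (λ _ → c) ≡ p * c
  ∑-const zero    c = refl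
  ∑-const (suc p) c = cong (c +_) (∑-const p c)

  ∑-≡0⇒≡0 : {f : Fin p → ℕ} → ∑ f ≡ 0 → ∀ i → f i ≡ 0
  ∑-≡0⇒≡0 {f = f} h i = n≤0⇒n≡0 (subst (f i ≤_) h (term≤∑ f i))

  ∑-≢0⇒∃ : (f : Fin p → ℕ) → ∑ f ≢ 0 → ∃ λ i → f i ≢ 0
  ∑-≢0⇒∃ {p} f h = ¬∀⟶∃¬ p (λ i → f i ≡ 0) (λ i → f i ≟ℕ 0) (h ∘ ∑-zero)

  sum-allFin : (f : Fin p → ℕ) → sum (map f (allFin p)) ≡ ∑ f
  sum-allFin f = trans (cong sum (map-tabulate id f)) (go f)
    where
    go : (f : Fin q → ℕ) → sum (tabulate f) ≡ ∑ f
    go {zero}  f = refl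
    go {suc q} f = cong (f zero +_) (go (f ∘ suc))

  ∣∣≡∑ : (S : Subset p) → ∣ S ∣ ≡ ∑ (ind ∘ lookup S)
  ∣∣≡∑ []          = refl
  ∣∣≡∑ (true ∷ S)  = cong suc (∣∣≡∑ S)
  ∣∣≡∑ (false ∷ S) = ∣∣≡∑ S

opaque
  wt : Subset p → (Fin p → ℕ) → ℕ
  wt M f = ∑ (λ e → ind (lookup M e) * f e)

  wt-mono : (M : Subset p) {f g : Fin p → ℕ} → (∀ e → f e ≤ g e) → wt M f ≤ wt M g
  wt-mono M h = ∑-mono (λ e → *-monoʳ-≤ (ind (lookup M e)) (h e))

  wt-cong : (M : Subset p) {f g : Fin p → ℕ} → (∀ e → lookup M e ≡ true → f e ≡ g e) → wt M f ≡ wt M g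
  wt-cong M {f} {g} h = ∑-cong pointwise
    where
    pointwise : ∀ e → ind (lookup M e) * f e ≡ ind (lookup M e) * g e
    pointwise e with lookup M e in eq
    ... | true  = cong (1 *_) (h e eq)
    ... | false = refl

  wt-⊥ : (f : Fin p → ℕ) → wt ⊥ˢ f ≡ 0
  wt-⊥ f = ∑-zero (λ e → cong (λ b → ind b * f e) (lookup-replicate e false))

  wt-+ : (M : Subset p) (f g : Fin p → ℕ) → wt M (λ e → f e + g e) ≡ wt M f + wt M g
  wt-+ M f g = trans (∑-cong (λ e → *-distribˡ-+ (ind (lookup M e)) (f e) (g e)))
    (∑-+ (λ e → ind (lookup M e) * f e) (λ e → ind (lookup M e) * g e))

  wt-*ʳ : (M : Subset p) (c : ℕ) → wt M (λ _ → c) ≡ c * wt M (λ _ → 1)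
  wt-*ʳ M c = trans (∑-cong (λ e → eq (ind (lookup M e)))) (sym (*-∑ c (λ e → ind (lookup M e) * 1)))
    where
    eq : ∀ b → b * c ≡ c * (b * 1)
    eq b = trans (*-comm b c) (cong (c *_) (sym (*-identityʳ b)))

  wt≤∑ : (M : Subset p) (f : Fin p → ℕ) → wt M f ≤ ∑ f
  wt≤∑ M f = ∑-mono (λ e → ≤-trans (*-monoˡ-≤ (f e) (ind≤1 (lookup M e))) (≤-reflexive (*-identityˡ (f e))))

  wt-∋ : (M : Subset p) (f : Fin p → ℕ) {e : Fin p} → lookup M e ≡ true → f e ≤ wt M f
  wt-∋ M f {e} eq = subst (_≤ wt M f) eq′ (term≤∑ (λ e → ind (lookup M e) * f e) e)
    where
    eq′ : ind (lookup M e) * f e ≡ f e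
    eq′ rewrite eq = *-identityˡ (f e)

  wt-∑ : (M : Subset p) (c : Fin q → ℕ) (g : Fin q → Fin p → ℕ) →
         ∑ (λ v → c v * wt M (g v)) ≡ wt M (λ e → ∑ (λ v → c v * g v e))
  wt-∑ M c g = begin
    ∑ (λ v → c v * wt M (g v))
      ≡⟨ ∑-cong (λ v → *-∑ (c v) _) ⟩
    ∑ (λ v → ∑ (λ e → c v * (ind (lookup M e) * g v e)))
      ≡⟨ ∑-comm _ ⟩
    ∑ (λ e → ∑ (λ v → c v * (ind (lookup M e) * g v e)))
      ≡⟨ ∑-cong (λ e → ∑-cong (λ v → eq (c v) (ind (lookup M e)) (g v e))) ⟩
    ∑ (λ e → ∑ (λ v → ind (lookup M e) * (c v * g v e)))
      ≡⟨ ∑-cong (λ e → sym (*-∑ (ind (lookup M e)) _)) ⟩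
    wt M (λ e → ∑ (λ v → c v * g v e)) ∎
    where
    open ≡-Reasoning
    eq : ∀ a b c → a * (b * c) ≡ b * (a * c)
    eq = solve-∀

  wt-≡ : (M : Subset p) (f : Fin p → ℕ) → wt M f ≡ ∑ (λ e → ind (lookup M e) * f e)
  wt-≡ M f = refl

  wt-≢0⇒∃ : (M : Subset p) (f : Fin p → ℕ) → wt M f ≢ 0 → ∃ λ e → lookup M e ≡ true × f e ≢ 0
  wt-≢0⇒∃ M f h with e , h′ ← ∑-≢0⇒∃ _ h with lookup M e in eq
  ... | true  = e , eq , λ z → h′ (trans (+-identityʳ _) z)
  ... | false = ⊥-elim (h′ refl)

opaque
  unfolding ∑ wt

  -- Quantifying over `f` records at once the effect on degrees (`f = inc v`), on size (`f`
  -- constantly 1) and on weight.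
  insert : (M : Subset p) {e : Fin p} → lookup M e ≡ false →
           ∃ λ M⁺ → ∀ f → wt M⁺ f ≡ f e + wt M f
  insert (false ∷ M) {zero}  refl = true ∷ M , λ f → cong (_+ wt M (f ∘ suc)) (+-identityʳ (f zero))
  insert (b ∷ M)     {suc e} eq   =
    let M⁺ , h = insert M eq in
    b ∷ M⁺ , λ f → trans (cong (ind b * f zero +_) (h (f ∘ suc)))
                         (comm (ind b * f zero) (f (suc e)) (wt M (f ∘ suc)))
    where
    comm : ∀ a b c → a + (b + c) ≡ b + (a + c)
    comm = solve-∀

  delete : (M : Subset p) {e : Fin p} → lookup M e ≡ true →
           ∃ λ M⁻ → ∀ f → wt M f ≡ f e + wt M⁻ f
  delete (true ∷ M) {zero}  refl = false ∷ M , λ f → cong (_+ wt M (f ∘ suc)) (+-identityʳ (f zero))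
  delete (b ∷ M)    {suc e} eq   =
    let M⁻ , h = delete M eq in
    b ∷ M⁻ , λ f → trans (cong (ind b * f zero +_) (h (f ∘ suc)))
                         (comm (ind b * f zero) (f (suc e)) (wt M⁻ (f ∘ suc)))
    where
    comm : ∀ a b c → a + (b + c) ≡ b + (a + c)
    comm = solve-∀

-- Exhaustive search over all subsets either finds a strict improvement or certifies the maximum.
-- The fuel `d` bounds the improvements left, since `f` never exceeds `B`.
∃-max : {P : Subset p → Set} → Decidable P → (f : Subset p → ℕ) (B : ℕ) → (∀ M → f M ≤ B) →
        ∃ P → ∃ λ M → P M × (∀ M′ → P M′ → f M′ ≤ f M)
∃-max {P = P} P? f B f≤B (M₀ , PM₀) = go B M₀ PM₀ (m≤n+m B (f M₀))
  where
  go : ∀ d M → P M → B ≤ f M + d → ∃ λ M → P M × (∀ M′ → P M′ → f M′ ≤ f M)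
  go d M PM B≤ with anySubset? (λ M′ → P? M′ ×-dec (suc (f M) ≤? f M′))
  go d M PM B≤ | no ¬∃ = M , PM , λ M′ PM′ → ≮⇒≥ (λ lt → ¬∃ (M′ , PM′ , lt))
  go zero M PM B≤ | yes (M′ , _ , lt) =
    ⊥-elim (<⇒≱ lt (≤-trans (f≤B M′) (subst (B ≤_) (+-identityʳ _) B≤)))
  go (suc d) M PM B≤ | yes (M′ , PM′ , lt) =
    go d M′ PM′ (≤-trans B≤ (≤-trans (≤-reflexive (+-suc (f M) d)) (+-monoˡ-≤ d lt)))

eqℕ-refl : (u : Fin p) → eqℕ u u ≡ 1
eqℕ-refl u with u ≟ u
... | yes _ = refl
... | no h  = ⊥-elim (h refl)

eqℕ-≢ : {u v : Fin p} → u ≢ v → eqℕ u v ≡ 0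
eqℕ-≢ {u = u} {v} h with u ≟ v
... | yes eq = ⊥-elim (h eq)
... | no _   = refl

eqℕ≡0⇒≢ : {u v : Fin p} → eqℕ u v ≡ 0 → u ≢ v
eqℕ≡0⇒≢ {u = u} h refl = 1+n≢0 (trans (sym (eqℕ-refl u)) h)

eqℕ≢0⇒≡ : {u v : Fin p} → eqℕ u v ≢ 0 → u ≡ v
eqℕ≢0⇒≡ {u = u} {v} h = decidable-stable (u ≟ v) (h ∘ eqℕ-≢)

∑-eqℕ : (c : Fin p → ℕ) (u : Fin p) → ∑ (λ v → c v * eqℕ u v) ≡ c u
∑-eqℕ c u = begin
  ∑ (λ v → c v * eqℕ u v) ≡⟨ ∑-single _ u (λ v v≢u → trans (cong (c v *_) (eqℕ-≢ (v≢u ∘ sym))) (*-zeroʳ (c v))) ⟩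
  c u * eqℕ u u           ≡⟨ cong (c u *_) (eqℕ-refl u) ⟩
  c u * 1                 ≡⟨ *-identityʳ (c u) ⟩
  c u                     ∎
  where open ≡-Reasoning

-- Matchings and exchanges along alternating paths.

module _ (G : Graph) where

  inc : Fin (n G) → Fin (m G) → ℕ
  inc v e = eqℕ (src G e) v + eqℕ (tgt G e) v

  degᴹ : Subset (m G) → Fin (n G) → ℕ
  degᴹ M v = wt M (inc v)

  size : Subset (m G) → ℕ
  size M = wt M (λ _ → 1)

  Matching : Subset (m G) → Set
  Matching M = ∀ v → degᴹ M v ≤ 1

  Joins : Fin (m G) → Fin (n G) → Fin (n G) → Set
  Joins e a b = ∀ v → inc v e ≡ eqℕ a v + eqℕ b v

  incident⇒Joins : ∀ {e v} → inc v e ≢ 0 → ∃ λ x → Joins e v x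
  incident⇒Joins {e} {v} h with src G e ≟ v
  ... | yes refl = tgt G e , λ _ → refl
  ... | no  _    with refl ← eqℕ≢0⇒≡ {u = tgt G e} {v} h = src G e , λ z → +-comm (eqℕ (src G e) z) _

  Joins-left : ∀ {e a b} → Joins e a b → 1 ≤ inc a e
  Joins-left {a = a} j = subst (1 ≤_) (sym (j a)) (≤-trans (≤-reflexive (sym (eqℕ-refl a))) (m≤m+n _ _))

  Joins-other : ∀ {e a b y} → Joins e a b → a ≢ y → b ≢ y → inc y e ≡ 0
  Joins-other j a≢y b≢y = trans (j _) (cong₂ _+_ (eqℕ-≢ a≢y) (eqℕ-≢ b≢y))

  addEdge : ∀ {M e a b} → Matching M → Joins e a b → a ≢ b → degᴹ M a ≡ 0 → degᴹ M b ≡ 0 →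
            ∃ λ M⁺ → Matching M⁺ × (∀ f → wt M⁺ f ≡ f e + wt M f)
  addEdge {M} {e} {a} {b} mM j a≢b Ma Mb with lookup M e in eq
  ... | true  = ⊥-elim (<⇒≱ (Joins-left j) (subst (inc a e ≤_) Ma (wt-∋ M (inc a) eq)))
  ... | false = let M⁺ , h = insert M eq in M⁺ , (λ v → subst (_≤ 1) (sym (h (inc v))) (bound v)) , h
    where
    bound : ∀ v → inc v e + degᴹ M v ≤ 1
    bound v rewrite j v with a ≟ v
    ... | yes refl rewrite Ma | eqℕ-≢ (a≢b ∘ sym) = s≤s z≤n
    ... | no a≢v with b ≟ v
    ...   | yes refl rewrite Mb = s≤s z≤n
    ...   | no b≢v = mM v

  -- A loop contributes 2 to the degree of its end, so a matching has none and `x` differs from `v`;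
  -- both ends had degree 1, carried by `e` alone.
  removeEdge : ∀ {M v} → Matching M → degᴹ M v ≢ 0 →
               ∃ λ e → ∃ λ x → ∃ λ M⁻ → Joins e v x × v ≢ x × Matching M⁻ ×
               degᴹ M⁻ v ≡ 0 × degᴹ M⁻ x ≡ 0 × (∀ f → wt M f ≡ f e + wt M⁻ f)
  removeEdge {M} {v} mM Mv≢0
    with e , eq , h ← wt-≢0⇒∃ M (inc v) Mv≢0
    with x , j ← incident⇒Joins {e} {v} h
    with M⁻ , w ← delete M eq =
    e , x , M⁻ , j , eqℕ≡0⇒≢ (proj₁ at-v) ∘ sym ,
    (λ z → ≤-trans (subst (degᴹ M⁻ z ≤_) (sym (w (inc z))) (m≤n+m _ _)) (mM z)) ,
    proj₂ at-v , at-x , w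
    where
    bound : ∀ z → eqℕ v z + eqℕ x z + degᴹ M⁻ z ≤ 1
    bound z = subst (_≤ 1) (trans (w (inc z)) (cong (_+ degᴹ M⁻ z) (j z))) (mM z)
    at-v : eqℕ x v ≡ 0 × degᴹ M⁻ v ≡ 0
    at-v with b ← bound v rewrite eqℕ-refl v with s≤s b′ ← b =
      m+n≡0⇒m≡0 (eqℕ x v) (n≤0⇒n≡0 b′) , m+n≡0⇒n≡0 (eqℕ x v) (n≤0⇒n≡0 b′)
    at-x : degᴹ M⁻ x ≡ 0
    at-x with b ← bound x rewrite eqℕ-refl x | +-comm (eqℕ v x) 1 with s≤s b′ ← b =
      m+n≡0⇒n≡0 (eqℕ v x) (n≤0⇒n≡0 b′)

  -- The alternating path from t in M ∪ N is walked two edges at a time: remove them both, recurse from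
  -- the vertex t₂ reached, and put them back in exchanged roles.
  swap : ∀ s {M N t u v} → Matching M → Matching N → t ≢ u → t ≢ v → u ≢ v →
         degᴹ M t ≡ 0 → degᴹ N u ≡ 0 → degᴹ N v ≡ 0 → size N < s →
         ∃ λ M′ → ∃ λ N′ → Matching M′ × Matching N′ ×
         (∀ f → wt M′ f + wt N′ f ≡ wt M f + wt N f) × size N′ ≤ size N ×
         degᴹ N′ t ≡ 0 × (degᴹ N′ u ≡ 0 ⊎ degᴹ N′ v ≡ 0)
  swap (suc s) {M} {N} {t} {u} {v} mM mN t≢u t≢v u≢v Mt Nu Nv (s≤s N≤s) with degᴹ N t ≟ℕ 0
  ... | yes Nt = M , N , mM , mN , (λ _ → refl) , ≤-refl , Nt , inj₁ Nu
  ... | no Nt≢0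
    with e₁ , t₁ , N⁻ , j₁ , t≢t₁ , mN⁻ , N⁻t , N⁻t₁ , w₁ ← removeEdge mN Nt≢0
    with degᴹ M t₁ ≟ℕ 0
  -- `M` misses `t₁`, so the path is the single edge `e₁`; it passes from `N` to `M`, and `N` gets
  -- smaller.
  ... | yes Mt₁ with M⁺ , mM⁺ , wM ← addEdge mM j₁ t≢t₁ Mt Mt₁ =
    M⁺ , N⁻ , mM⁺ , mN⁻ , balance , ≤-trans (m≤n+m _ 1) (≤-reflexive (sym (w₁ (λ _ → 1)))) ,
    N⁻t , inj₁ (m+n≡0⇒n≡0 _ (trans (sym (w₁ _)) Nu))
    where
    balance : ∀ f → wt M⁺ f + wt N⁻ f ≡ wt M f + wt N f
    balance f rewrite wM f | w₁ f = rearr (f e₁) (wt M f) (wt N⁻ f)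
      where
      rearr : ∀ a b c → a + b + c ≡ b + (a + c)
      rearr = solve-∀
  ... | no Mt₁≢0
    with e₂ , t₂ , M⁻ , j₂ , t₁≢t₂ , mM⁻ , M⁻t₁ , M⁻t₂ , w₂ ← removeEdge mM Mt₁≢0
    = result (t₂ ≟ u) (t₂ ≟ v)
    where
    Mt-split : inc t e₂ + degᴹ M⁻ t ≡ 0
    Mt-split = trans (sym (w₂ (inc t))) Mt
    M⁻t : degᴹ M⁻ t ≡ 0
    M⁻t = m+n≡0⇒n≡0 _ Mt-split
    t₂≢t : t₂ ≢ t
    t₂≢t = eqℕ≡0⇒≢ (m+n≡0⇒n≡0 (eqℕ t₁ t) (trans (sym (j₂ t)) (m+n≡0⇒m≡0 _ Mt-split)))
    N⁻≡0 : ∀ {y} → degᴹ N y ≡ 0 → degᴹ N⁻ y ≡ 0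
    N⁻≡0 Ny = m+n≡0⇒n≡0 _ (trans (sym (w₁ _)) Ny)
    t₁≢ : ∀ {y} → degᴹ N y ≡ 0 → t₁ ≢ y
    t₁≢ Ny refl with () ← trans (sym (eqℕ-refl t₁))
      (m+n≡0⇒n≡0 (eqℕ t t₁) (trans (sym (j₁ t₁)) (m+n≡0⇒m≡0 (inc t₁ e₁) (trans (sym (w₁ _)) Ny))))

    -- Once the path beyond `t₂` has been exchanged, `e₁` returns on the `M` side and `e₂` on the
    -- `N` side. The vertex `y` is the one of `u`, `v` that stays missed.
    finish : ∀ {M₁ N₁ y} → Matching M₁ → Matching N₁ →
             (∀ f → wt M₁ f + wt N₁ f ≡ wt M⁻ f + wt N⁻ f) → size N₁ ≤ size N⁻ →
             degᴹ N₁ t₂ ≡ 0 → degᴹ N₁ y ≡ 0 → degᴹ N y ≡ 0 → t₂ ≢ y →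
             ∃ λ M′ → ∃ λ N′ → Matching M′ × Matching N′ ×
             (∀ f → wt M′ f + wt N′ f ≡ wt M f + wt N f) × size N′ ≤ size N ×
             degᴹ N′ t ≡ 0 × degᴹ N′ y ≡ 0
    finish {M₁} {N₁} {y} mM₁ mN₁ bal N₁≤ N₁t₂ N₁y Ny t₂≢y
      with both-t ← trans (bal (inc t)) (cong₂ _+_ M⁻t N⁻t)
         | both-t₁ ← trans (bal (inc t₁)) (cong₂ _+_ M⁻t₁ N⁻t₁)
      with M′ , mM′ , wM ← addEdge mM₁ j₁ t≢t₁ (m+n≡0⇒m≡0 _ both-t) (m+n≡0⇒m≡0 _ both-t₁)
         | N′ , mN′ , wN ← addEdge mN₁ j₂ t₁≢t₂ (m+n≡0⇒n≡0 (degᴹ M₁ t₁) both-t₁) N₁t₂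
      = M′ , N′ , mM′ , mN′ , balance , size≤ ,
        trans (wN _) (cong₂ _+_ (Joins-other j₂ (t≢t₁ ∘ sym) t₂≢t) (m+n≡0⇒n≡0 (degᴹ M₁ t) both-t)) ,
        trans (wN _) (cong₂ _+_ (Joins-other j₂ (t₁≢ Ny) t₂≢y) N₁y)
      where
      balance : ∀ f → wt M′ f + wt N′ f ≡ wt M f + wt N f
      balance f rewrite wM f | wN f | w₁ f | w₂ f =
        trans (pull (f e₁) (f e₂) (wt M₁ f) (wt N₁ f))
        (trans (cong (f e₁ + f e₂ +_) (bal f)) (push (f e₁) (f e₂) (wt M⁻ f) (wt N⁻ f)))
        where
        pull : ∀ a b c d → (a + c) + (b + d) ≡ a + b + (c + d)
        pull = solve-∀
        push : ∀ a b c d → a + b + (c + d) ≡ (b + c) + (a + d)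
        push = solve-∀
      size≤ : size N′ ≤ size N
      size≤ = subst₂ _≤_ (sym (wN (λ _ → 1))) (sym (w₁ (λ _ → 1))) (s≤s N₁≤)

    result : Dec (t₂ ≡ u) → Dec (t₂ ≡ v) →
             ∃ λ M′ → ∃ λ N′ → Matching M′ × Matching N′ ×
             (∀ f → wt M′ f + wt N′ f ≡ wt M f + wt N f) × size N′ ≤ size N ×
             degᴹ N′ t ≡ 0 × (degᴹ N′ u ≡ 0 ⊎ degᴹ N′ v ≡ 0)
    -- The path ends at `u`, which `e₂` now covers in `N′`, so `v` stays missed. Having only one end
    -- besides `t`, the path cannot reach both.
    result (yes refl) _ =
      let M′ , N′ , a , b , c , d , e , f = finish mM⁻ mN⁻ (λ _ → refl) ≤-refl (N⁻≡0 Nu) (N⁻≡0 Nv) Nv u≢v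
      in M′ , N′ , a , b , c , d , e , inj₂ f
    result (no t₂≢u) (yes refl) =
      let M′ , N′ , a , b , c , d , e , f = finish mM⁻ mN⁻ (λ _ → refl) ≤-refl (N⁻≡0 Nv) (N⁻≡0 Nu) Nu (u≢v ∘ sym)
      in M′ , N′ , a , b , c , d , e , inj₁ f
    result (no t₂≢u) (no t₂≢v)
      with swap s mM⁻ mN⁻ t₂≢u t₂≢v u≢v M⁻t₂ (N⁻≡0 Nu) (N⁻≡0 Nv)
             (subst (_≤ s) (w₁ (λ _ → 1)) N≤s)
    ... | M₁ , N₁ , mM₁ , mN₁ , bal , N₁≤ , N₁t₂ , inj₁ N₁u =
      let M′ , N′ , a , b , c , d , e , f = finish mM₁ mN₁ bal N₁≤ N₁t₂ N₁u Nu t₂≢u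
      in M′ , N′ , a , b , c , d , e , inj₁ f
    ... | M₁ , N₁ , mM₁ , mN₁ , bal , N₁≤ , N₁t₂ , inj₂ N₁v =
      let M′ , N′ , a , b , c , d , e , f = finish mM₁ mN₁ bal N₁≤ N₁t₂ N₁v Nv t₂≢v
      in M′ , N′ , a , b , c , d , e , inj₂ f

-- Canonical colours for the classes of an equivalence relation.

unique⇒∑≤1 : (f : Fin p → ℕ) → (∀ i → f i ≤ 1) → (∀ i j → f i ≢ 0 → f j ≢ 0 → i ≡ j) → ∑ f ≤ 1
unique⇒∑≤1 f f≤1 uniq with ∑ f ≟ℕ 0
... | yes z = subst (_≤ 1) (sym z) z≤n
... | no nz with i , fi ← ∑-≢0⇒∃ f nz =
  subst (_≤ 1) (sym (∑-single f i (λ j j≢i → decidable-stable (f j ≟ℕ 0) (λ fj → j≢i (uniq j i fj fi))))) (f≤1 i)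

-- The search stops at `d`, which doubles as the default. If `f d` is true, the result is the least
-- index with `f` true, whatever `d` was.
first : (Fin p → Bool) → Fin p → Fin p
first f zero    = zero
first f (suc d) = if f zero then zero else suc (first (f ∘ suc) d)

first-true : (f : Fin p → Bool) (d : Fin p) → f d ≡ true → f (first f d) ≡ true
first-true f zero    fd = fd
first-true f (suc d) fd with f zero in eq
... | true  = eq
... | false = first-true (f ∘ suc) d fd

first-unique : (f g : Fin p → Bool) (d d′ : Fin p) → (∀ i → f i ≡ g i) → f d ≡ true → g d′ ≡ true →
               first f d ≡ first g d′
first-unique f g zero    zero     h fd gd = refl
first-unique f g zero    (suc d′) h fd gd rewrite sym (h zero) | fd = refl
first-unique f g (suc d) zero     h fd gd rewrite h zero | gd = refl
first-unique f g (suc d) (suc d′) h fd gd rewrite h zero with g zero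
... | true  = refl
... | false = cong suc (first-unique (f ∘ suc) (g ∘ suc) d d′ (h ∘ suc) fd gd)

-- The colour of an element is the least member of its class; related elements have equal rows in
-- `related`, hence equal least members.
colouring : {R : Rel (Fin p) 0ℓ} → IsEquivalence R → (∀ u v → Dec (R u v)) →
            ∃ λ (col : Fin p → Fin p) → (∀ {u v} → R u v → col u ≡ col v) × (∀ {u v} → col u ≡ col v → R u v)
colouring {R = R} equiv R? = col ,
  (λ {u} {v} r → first-unique (related u) (related v) u v (respects r) (complete (Eq.refl {u})) (complete (Eq.refl {v}))) ,
  (λ {u} {v} eq → Eq.trans (col-related u) (Eq.sym (subst (R v) (sym eq) (col-related v))))
  where
  module Eq = IsEquivalence equiv
  related : Fin _ → Fin _ → Bool
  related u v = ⌊ R? u v ⌋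
  col : Fin _ → Fin _
  col u = first (related u) u
  complete : ∀ {u v} → R u v → related u v ≡ true
  complete {u} {v} r with R? u v
  ... | yes _ = refl
  ... | no ¬r = ⊥-elim (¬r r)
  sound : ∀ {u v} → related u v ≡ true → R u v
  sound {u} {v} h with yes r ← R? u v = r
  col-related : ∀ u → R u (col u)
  col-related u = sound (first-true (related u) u (complete Eq.refl))
  respects : ∀ {u v} → R u v → ∀ x → related u x ≡ related v x
  respects {u} {v} r x with R? u x | R? v x
  ... | yes _ | yes _ = refl
  ... | yes a | no ¬b = ⊥-elim (¬b (Eq.trans (Eq.sym r) a))
  ... | no ¬a | yes b = ⊥-elim (¬a (Eq.trans r b))
  ... | no _  | no _  = refl

-- Lowering weights with truncation at zero.

⊓+∸-∑ : (c w : Fin p → ℕ) → ∑ w ≡ ∑ (λ e → c e ⊓ w e) + ∑ (λ e → w e ∸ c e)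
⊓+∸-∑ c w = trans (∑-cong (λ e → sym (m⊓n+n∸m≡n (c e) (w e)))) (∑-+ _ _)

∸-decreases : ∀ {s} (c w : Fin p → ℕ) → 1 ≤ ∑ (λ e → c e ⊓ w e) → ∑ w ≤ suc s → ∑ (λ e → w e ∸ c e) ≤ s
∸-decreases c w 1≤ ∑≤s = ≤-pred (≤-trans (+-monoˡ-≤ _ 1≤) (≤-trans (≤-reflexive (sym (⊓+∸-∑ c w))) ∑≤s))

⊓+∸-wt : (M : Subset p) (c w : Fin p → ℕ) → wt M w ≡ wt M (λ e → c e ⊓ w e) + wt M (λ e → w e ∸ c e)
⊓+∸-wt M c w = trans (wt-cong M (λ e _ → sym (m⊓n+n∸m≡n (c e) (w e)))) (wt-+ M _ _)

-- Blossom inequalities and near-perfect matchings on classes.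

module _ (G : Graph) where

  ∑-inc : (c : Fin (n G) → ℕ) (e : Fin (m G)) → ∑ (λ v → c v * inc G v e) ≡ c (src G e) + c (tgt G e)
  ∑-inc c e = begin
    ∑ (λ v → c v * inc G v e)
      ≡⟨ ∑-cong (λ v → *-distribˡ-+ (c v) (eqℕ (src G e) v) (eqℕ (tgt G e) v)) ⟩
    ∑ (λ v → c v * eqℕ (src G e) v + c v * eqℕ (tgt G e) v)
      ≡⟨ ∑-+ _ _ ⟩
    ∑ (λ v → c v * eqℕ (src G e) v) + ∑ (λ v → c v * eqℕ (tgt G e) v)
      ≡⟨ cong₂ _+_ (∑-eqℕ c (src G e)) (∑-eqℕ c (tgt G e)) ⟩
    c (src G e) + c (tgt G e) ∎
    where open ≡-Reasoning

  handshake : (M : Subset (m G)) (c : Fin (n G) → ℕ) →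
              ∑ (λ v → c v * degᴹ G M v) ≡ wt M (λ e → c (src G e) + c (tgt G e))
  handshake M c = trans (wt-∑ M c (inc G)) (wt-cong M (λ e _ → ∑-inc c e))

  -- The condition that 1/r satisfies Edmonds' blossom inequalities.
  Sparse : ℕ → Set
  Sparse r = (K : Fin (n G) → Bool) (h : ℕ) → ∑ (ind ∘ K) ≤ 1 + 2 * h →
             ∑ (λ e → ind (K (src G e) ∧ K (tgt G e))) ≤ r * h

  module _ {r : ℕ} (sparse : Sparse r) where

    -- Each class has at most one vertex missed by `N`, so if it contains `a` edges of `N` it has at
    -- most `1 + 2 * a` vertices, and sparsity with `h = a` allows it at most `r * a` edges. Every
    -- edge of `N` and every edge with `p` nonzero lies in one class, so summing over the classes
    -- finishes.
    ∑≤r*size : {N : Subset (m G)} (col : Fin (n G) → Fin (n G)) (p : Fin (m G) → ℕ) →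
               (∀ e → p e ≤ 1) → (∀ e → p e ≢ 0 → col (src G e) ≡ col (tgt G e)) →
               (∀ e → lookup N e ≡ true → col (src G e) ≡ col (tgt G e)) →
               (∀ u v → degᴹ G N u ≡ 0 → degᴹ G N v ≡ 0 → col u ≡ col v → u ≡ v) →
               ∑ p ≤ r * size G N
    ∑≤r*size {N} col p p≤1 col-p col-N near-perfect = begin
      ∑ p
        ≡⟨ ∑-cong (λ e → sym (∑-eqℕ (λ _ → p e) (col (src G e)))) ⟩
      ∑ (λ e → ∑ (λ k → p e * eqℕ (col (src G e)) k))
        ≡⟨ ∑-comm _ ⟩
      ∑ (λ k → ∑ (λ e → p e * eqℕ (col (src G e)) k))
        ≤⟨ ∑-mono (λ k → ∑-mono (inside k)) ⟩
      ∑ (λ k → ∑ (λ e → ind (class k (src G e) ∧ class k (tgt G e))))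
        ≤⟨ ∑-mono (λ k → sparse (class k) (a k) (class-size k)) ⟩
      ∑ (λ k → r * a k)
        ≡⟨ *-∑ r a ⟨
      r * ∑ a
        ≡⟨ cong (r *_) (trans (∑-cong (λ k → sym (*-identityˡ (a k)))) (wt-∑ N (λ _ → 1) (λ k e → eqℕ (col (src G e)) k))) ⟩
      r * wt N (λ e → ∑ (λ k → 1 * eqℕ (col (src G e)) k))
        ≡⟨ cong (r *_) (wt-cong N (λ e _ → ∑-eqℕ (λ _ → 1) (col (src G e)))) ⟩
      r * size G N ∎
      where
      open ≤-Reasoning
      class : Fin (n G) → Fin (n G) → Bool
      class k v = ⌊ col v ≟ k ⌋
      a : Fin (n G) → ℕ
      a k = wt N (λ e → eqℕ (col (src G e)) k)
      inside : ∀ k e → p e * eqℕ (col (src G e)) k ≤ ind (class k (src G e) ∧ class k (tgt G e))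
      inside k e with p e ≟ℕ 0
      ... | yes z rewrite z = z≤n
      ... | no nz rewrite col-p e nz with class k (tgt G e)
      ...   | true  = ≤-trans (≤-reflexive (*-identityʳ (p e))) (p≤1 e)
      ...   | false = ≤-reflexive (*-zeroʳ (p e))
      missed : Fin (n G) → Fin (n G) → ℕ
      missed k v = eqℕ (col v) k * (1 ∸ degᴹ G N v)
      missed-class : ∀ {k v} → missed k v ≢ 0 → col v ≡ k
      missed-class {k} {v} h = eqℕ≢0⇒≡ (λ z → h (cong (_* (1 ∸ degᴹ G N v)) z))
      missed-deg : ∀ {k v} → missed k v ≢ 0 → degᴹ G N v ≡ 0
      missed-deg {k} {v} h with degᴹ G N v
      ... | zero  = refl
      ... | suc d = ⊥-elim (h (trans (cong (eqℕ (col v) k *_) (0∸n≡0 d)) (*-zeroʳ (eqℕ (col v) k))))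
      missed≤1 : ∀ k → ∑ (missed k) ≤ 1
      missed≤1 k = unique⇒∑≤1 (missed k) (λ v → *-mono-≤ (ind≤1 (class k v)) (m∸n≤m 1 (degᴹ G N v)))
        (λ u v hu hv → near-perfect u v (missed-deg {k} hu) (missed-deg {k} hv) (trans (missed-class hu) (sym (missed-class hv))))
      class-size : ∀ k → ∑ (ind ∘ class k) ≤ 1 + 2 * a k
      class-size k = begin
        ∑ (ind ∘ class k)
          ≤⟨ ∑-mono (λ v → split (eqℕ (col v) k) (degᴹ G N v)) ⟩
        ∑ (λ v → missed k v + eqℕ (col v) k * degᴹ G N v)
          ≡⟨ ∑-+ _ _ ⟩
        ∑ (missed k) + ∑ (λ v → eqℕ (col v) k * degᴹ G N v)
          ≡⟨ cong (∑ (missed k) +_) (trans (handshake N (λ v → eqℕ (col v) k)) doubled) ⟩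
        ∑ (missed k) + 2 * a k
          ≤⟨ +-monoˡ-≤ (2 * a k) (missed≤1 k) ⟩
        1 + 2 * a k ∎
        where
        split : ∀ x d → x ≤ x * (1 ∸ d) + x * d
        split x zero    = ≤-reflexive (trans (sym (*-identityʳ x)) (sym (trans (cong (x * 1 +_) (*-zeroʳ x)) (+-identityʳ _))))
        split x (suc d) = ≤-trans (≤-trans (≤-reflexive (sym (*-identityʳ x))) (*-monoʳ-≤ x (s≤s z≤n))) (m≤n+m _ (x * (0 ∸ d)))
        doubled : wt N (λ e → eqℕ (col (src G e)) k + eqℕ (col (tgt G e)) k) ≡ 2 * a k
        doubled = trans (wt-cong N (λ e e∈N → cong (λ c → eqℕ (col (src G e)) k + eqℕ c k) (sym (col-N e e∈N))))
                        (trans (wt-+ N _ _) (cong (a k +_) (sym (+-identityʳ (a k)))))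

-- Edmonds' theorem by induction on the total weight.

module _ (G : Graph) where

  -- The second condition confines `M` to edges of positive weight. Written as a vanishing `wt`, it
  -- is carried through `swap` and `addEdge`, whose weight identities hold for every function.
  Admissible : (Fin (m G) → ℕ) → Subset (m G) → Set
  Admissible w M = Matching G M × wt M (λ e → 1 ∸ w e) ≡ 0

  admissible? : ∀ w → Decidable (Admissible w)
  admissible? w M = all? (λ v → degᴹ G M v ≤? 1) ×-dec (wt M (λ e → 1 ∸ w e) ≟ℕ 0)

  ⊥-admissible : ∀ w → Admissible w ⊥ˢ
  ⊥-admissible w = (λ v → subst (_≤ 1) (sym (wt-⊥ (inc G v))) z≤n) , wt-⊥ _

  admissible-anti : ∀ {w w′ M} → (∀ e → w′ e ≤ w e) → Admissible w′ M → Admissible w M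
  admissible-anti {M = M} w′≤w (mM , z) =
    mM , n≤0⇒n≡0 (subst (_ ≤_) z (wt-mono M (λ e → ∸-monoʳ-≤ 1 (w′≤w e))))

  admissible⇒1≤w : ∀ {w M e} → Admissible w M → lookup M e ≡ true → 1 ≤ w e
  admissible⇒1≤w {w} {M} {e} (_ , z) e∈M = m∸n≡0⇒m≤n (n≤0⇒n≡0 (subst (1 ∸ w e ≤_) z (wt-∋ M _ e∈M)))

  -- Every edge of an admissible matching has weight at least 1, so lowering by 1 is never truncated
  -- on it.
  wt≡size+wt∸1 : ∀ {w M} → Admissible w M → wt M w ≡ size G M + wt M (λ e → w e ∸ 1)
  wt≡size+wt∸1 {w} {M} adm = trans (⊓+∸-wt M (λ _ → 1) w)
    (cong (_+ wt M (λ e → w e ∸ 1)) (wt-cong M (λ e e∈M → m≤n⇒m⊓n≡m (admissible⇒1≤w {w} adm e∈M))))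

  covered⇒1≤wt : ∀ {w M u} → Admissible w M → degᴹ G M u ≢ 0 → 1 ≤ wt M (λ e → inc G u e ⊓ w e)
  covered⇒1≤wt {w} {M} {u} adm Mu with e , e∈M , h ← wt-≢0⇒∃ M _ Mu =
    ≤-trans (⊓-glb (n≢0⇒n>0 h) (admissible⇒1≤w {w} adm e∈M)) (wt-∋ M (λ e → inc G u e ⊓ w e) e∈M)

  module _ {r : ℕ} (deg≤r : ∀ v → ∑ (inc G v) ≤ r) (sparse : Sparse G r) where

    Heavy : (Fin (m G) → ℕ) → Subset (m G) → Set
    Heavy w M = Admissible w M × ∑ w ≤ r * wt M w

    Maximum : (Fin (m G) → ℕ) → Subset (m G) → Set
    Maximum w M = Admissible w M × (∀ M′ → Admissible w M′ → wt M′ w ≤ wt M w)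

    -- Lowering the edges at `u` costs the total at most the degree of `u`, hence at most `r`, while
    -- the lowered weight of `N` falls short of the old maximum by at least 1.
    heavy-covering : ∀ {w u M N} → Maximum w M → (∀ M → Maximum w M → degᴹ G M u ≢ 0) →
                     Heavy (λ e → w e ∸ inc G u e) N → Heavy w M
    heavy-covering {w} {u} {M} {N} (aM , maxM) covered (aN , N-heavy) = aM , (begin
      ∑ w                                   ≡⟨ ⊓+∸-∑ (inc G u) w ⟩
      ∑ (λ e → inc G u e ⊓ w e) + ∑ w′      ≤⟨ +-mono-≤ (≤-trans (∑-mono (λ e → m⊓n≤m (inc G u e) (w e))) (deg≤r u)) N-heavy ⟩
      r + r * wt N w′                       ≡⟨ *-suc r (wt N w′) ⟨
      r * suc (wt N w′)                     ≤⟨ *-monoʳ-≤ r loss ⟩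
      r * wt M w                            ∎)
      where
      open ≤-Reasoning
      w′ = λ e → w e ∸ inc G u e
      w′≤w : ∀ e → w′ e ≤ w e
      w′≤w e = m∸n≤m (w e) (inc G u e)
      aN′ : Admissible w N
      aN′ = admissible-anti w′≤w aN
      -- Either `N` was already below the maximum for `w`, or it is a maximum matching; then it
      -- covers `u` by an edge of positive weight and loses at least 1.
      loss : suc (wt N w′) ≤ wt M w
      loss with suc (wt N w) ≤? wt M w
      ... | yes lt = ≤-trans (s≤s (wt-mono N w′≤w)) lt
      ... | no ¬lt = begin
        1 + wt N w′                            ≤⟨ +-monoˡ-≤ (wt N w′) (covered⇒1≤wt aN′ (covered N (aN′ , λ M′ aM′ → ≤-trans (maxM M′ aM′) (≮⇒≥ ¬lt)))) ⟩
        wt N (λ e → inc G u e ⊓ w e) + wt N w′ ≡⟨ ⊓+∸-wt N (inc G u) w ⟨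
        wt N w                                 ≤⟨ maxM N aN′ ⟩
        wt M w                                 ∎

    -- As in Gallai's lemma, "no extremal matching misses both u and v" is an equivalence relation.
    heavy-avoiding : ∀ {w N} → (∀ t → ∃ λ M → Maximum w M × degᴹ G M t ≡ 0) →
                     Heavy (λ e → w e ∸ 1) N → ∃ (Heavy w)
    heavy-avoiding {w} {N₀} avoid (aN₀ , N₀-heavy)
      with ∃-max good? (λ M → wt M w) (∑ w) (λ M → wt≤∑ M w) (N₀ , admissible-anti w′≤w aN₀ , N₀-heavy)
      where
      w′≤w : ∀ e → w e ∸ 1 ≤ w e
      w′≤w e = m∸n≤m (w e) 1
      -- Admissibility is required for `w` only, so edges of weight exactly 1 are allowed; `edge⇒~`
      -- may have to add such an edge.
      good? : Decidable (λ N → Admissible w N × ∑ (λ e → w e ∸ 1) ≤ r * wt N (λ e → w e ∸ 1))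
      good? N = admissible? w N ×-dec (_ ≤? _)
    ... | N , (aN , N-good) , N-max = N , aN , (begin
      ∑ w                            ≡⟨ ⊓+∸-∑ (λ _ → 1) w ⟩
      ∑ (λ e → 1 ⊓ w e) + ∑ w′       ≤⟨ +-mono-≤ positive≤ N-good ⟩
      r * size G N + r * wt N w′     ≡⟨ *-distribˡ-+ r (size G N) (wt N w′) ⟨
      r * (size G N + wt N w′)       ≡⟨ cong (r *_) (wt≡size+wt∸1 aN) ⟨
      r * wt N w                     ∎)
      where
      open ≤-Reasoning
      w′ : Fin (m G) → ℕ
      w′ e = w e ∸ 1

      Extremal : Subset (m G) → Set
      Extremal M = (Admissible w M × ∑ w′ ≤ r * wt M w′) × wt N w ≤ wt M w

      extremal? : Decidable Extremal
      extremal? M = (admissible? w M ×-dec (_ ≤? _)) ×-dec (_ ≤? _)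

      MissedTogether : Rel (Fin (n G)) 0ℓ
      MissedTogether u v = ∃ λ M → Extremal M × degᴹ G M u ≡ 0 × degᴹ G M v ≡ 0

      missedTogether? : ∀ u v → Dec (MissedTogether u v)
      missedTogether? u v = anySubset? (λ M → extremal? M ×-dec (degᴹ G M u ≟ℕ 0) ×-dec (degᴹ G M v ≟ℕ 0))

      -- The clause `u ≡ v` secures reflexivity: `MissedTogether u u` holds as soon as some extremal
      -- matching misses `u`.
      _~_ : Rel (Fin (n G)) 0ℓ
      u ~ v = u ≡ v ⊎ ¬ MissedTogether u v

      _~?_ : ∀ u v → Dec (u ~ v)
      u ~? v = (u ≟ v) ⊎-dec ¬? (missedTogether? u v)

      -- Exchange `B` with a maximum matching `A` missing `t`. As `A′` weighs no more than `A`, `B′`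
      -- weighs at least as much as `B`; its size has not grown, so its weight under `w′` has not
      -- dropped either. Thus `B′` is extremal, and it misses `t` and one of `u`, `v`.
      shift : ∀ {u t v} → u ≢ t → t ≢ v → u ≢ v → MissedTogether u v → MissedTogether u t ⊎ MissedTogether t v
      shift {u} {t} {v} u≢t t≢v u≢v (B , ((aB , B-good) , B-max) , Bu , Bv)
        with A , (aA , A-max) , At ← avoid t
        with A′ , B′ , mA′ , mB′ , bal , B′≤B , B′t , B′uv ←
          swap G (suc (size G B)) (proj₁ aA) (proj₁ aB) (u≢t ∘ sym) t≢v u≢v At Bu Bv ≤-refl
        = pick B′uv
        where
        support : wt A′ (λ e → 1 ∸ w e) + wt B′ (λ e → 1 ∸ w e) ≡ 0
        support = trans (bal _) (cong₂ _+_ (proj₂ aA) (proj₂ aB))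
        aA′ : Admissible w A′
        aA′ = mA′ , m+n≡0⇒m≡0 _ support
        aB′ : Admissible w B′
        aB′ = mB′ , m+n≡0⇒n≡0 (wt A′ _) support
        B≤B′ : wt B w ≤ wt B′ w
        B≤B′ = +-cancelˡ-≤ (wt A w) _ _ (≤-trans (≤-reflexive (sym (bal w))) (+-monoˡ-≤ (wt B′ w) (A-max A′ aA′)))
        B≤B′′ : wt B w′ ≤ wt B′ w′
        B≤B′′ = +-cancelˡ-≤ (size G B) _ _ (begin
          size G B + wt B w′   ≡⟨ wt≡size+wt∸1 aB ⟨
          wt B w               ≤⟨ B≤B′ ⟩
          wt B′ w              ≡⟨ wt≡size+wt∸1 aB′ ⟩
          size G B′ + wt B′ w′ ≤⟨ +-monoˡ-≤ (wt B′ w′) B′≤B ⟩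
          size G B + wt B′ w′  ∎)
        extremal : Extremal B′
        extremal = (aB′ , ≤-trans B-good (*-monoʳ-≤ r B≤B′′)) , ≤-trans B-max B≤B′
        pick : degᴹ G B′ u ≡ 0 ⊎ degᴹ G B′ v ≡ 0 → MissedTogether u t ⊎ MissedTogether t v
        pick (inj₁ B′u) = inj₁ (B′ , extremal , B′u , B′t)
        pick (inj₂ B′v) = inj₂ (B′ , extremal , B′t , B′v)

      ~-trans : ∀ {u t v} → u ~ t → t ~ v → u ~ v
      ~-trans (inj₁ refl) tv = tv
      ~-trans ut (inj₁ refl) = ut
      ~-trans {u} {t} {v} (inj₂ ¬ut) (inj₂ ¬tv) with u ≟ v
      ... | yes u≡v = inj₁ u≡v
      ... | no u≢v with u ≟ t | t ≟ v
      ...   | yes refl | _ = inj₂ ¬tv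
      ...   | no _ | yes refl = inj₂ ¬ut
      ...   | no u≢t | no t≢v = inj₂ (λ uv → [ ¬ut , ¬tv ]′ (shift u≢t t≢v u≢v uv))

      ~-equiv : IsEquivalence _~_
      ~-equiv = record
        { refl  = inj₁ refl
        ; sym   = ⊎-map sym (λ ¬uv (M , ext , Mv , Mu) → ¬uv (M , ext , Mu , Mv))
        ; trans = ~-trans
        }

      -- An extremal matching missing two distinct ends could be enlarged by `e`; the result stays
      -- good for the lowered weights and is strictly heavier than `N`, against the choice of `N`.
      edge⇒~ : ∀ e → 1 ≤ w e → src G e ~ tgt G e
      edge⇒~ e 1≤we with src G e ≟ tgt G e
      ... | yes s≡t = inj₁ s≡t
      ... | no s≢t = inj₂ impossible
        where
        impossible : ¬ MissedTogether (src G e) (tgt G e)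
        impossible (M , (((mM , z) , M-good) , M-max) , Ms , Mt)
          with M⁺ , mM⁺ , h ← addEdge G mM (λ _ → refl) s≢t Ms Mt =
          <⇒≱ (subst (suc (wt M w) ≤_) (sym (h w)) (+-monoˡ-≤ (wt M w) 1≤we))
              (≤-trans (N-max M⁺ ((mM⁺ , trans (h _) (cong₂ _+_ (m≤n⇒m∸n≡0 1≤we) z)) ,
                                  ≤-trans M-good (*-monoʳ-≤ r (subst (wt M w′ ≤_) (sym (h w′)) (m≤n+m _ _)))))
                       M-max)

      positive≤ : ∑ (λ e → 1 ⊓ w e) ≤ r * size G N
      positive≤ with col , ~⇒col , col⇒~ ← colouring ~-equiv _~?_ =
        ∑≤r*size G {r} sparse col (λ e → 1 ⊓ w e) (λ e → m⊓n≤m 1 (w e))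
          (λ e h → ~⇒col (edge⇒~ e (≤-trans (n≢0⇒n>0 h) (m⊓n≤n 1 (w e)))))
          (λ e e∈N → ~⇒col (edge⇒~ e (admissible⇒1≤w {w} aN e∈N)))
          -- `N` is itself extremal, so two vertices of one class that it misses must coincide.
          (λ u v Nu Nv eq → [ id , (λ ¬uv → ⊥-elim (¬uv (N , ((aN , N-good) , ≤-refl) , Nu , Nv))) ]′ (col⇒~ eq))

    -- Here `s` bounds the total weight. Both reductions lower the total: either all positive
    -- weights drop, or that of some edge at a vertex `u` covered by a maximum matching.
    ∃-heavy : ∀ s w → ∑ w ≤ s → ∃ (Heavy w)
    ∃-heavy s w ∑≤s with ∑ w ≟ℕ 0
    ... | yes z = ⊥ˢ , ⊥-admissible w , subst (_≤ r * wt ⊥ˢ w) (sym z) z≤n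
    ∃-heavy zero w ∑≤s | no nz = ⊥-elim (nz (n≤0⇒n≡0 ∑≤s))
    ∃-heavy (suc s) w ∑≤s | no nz
      with M , aM , M-max ← ∃-max (admissible? w) (λ M → wt M w) (∑ w) (λ M → wt≤∑ M w) (⊥ˢ , ⊥-admissible w)
      -- Being at least as heavy as `M` stands for being maximum, which makes the case distinction
      -- decidable.
      with all? (λ t → anySubset? (λ M′ → admissible? w M′ ×-dec (wt M w ≤? wt M′ w) ×-dec (degᴹ G M′ t ≟ℕ 0)))
    ... | yes avoidable = heavy-avoiding
            (λ t → let M′ , aM′ , M≤M′ , M′t = avoidable t in
                   M′ , (aM′ , λ M″ aM″ → ≤-trans (M-max M″ aM″) M≤M′) , M′t)
            (proj₂ (∃-heavy s (λ e → w e ∸ 1) (∸-decreases (λ _ → 1) w 1≤ ∑≤s)))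
      where
      1≤ : 1 ≤ ∑ (λ e → 1 ⊓ w e)
      1≤ with e , we ← ∑-≢0⇒∃ w nz = ≤-trans (⊓-glb ≤-refl (n≢0⇒n>0 we)) (term≤∑ (λ e → 1 ⊓ w e) e)
    ... | no ¬avoidable
      with u , ¬u ← ¬∀⟶∃¬ (n G) _ (λ t → anySubset? (λ M′ → admissible? w M′ ×-dec (wt M w ≤? wt M′ w) ×-dec (degᴹ G M′ t ≟ℕ 0))) ¬avoidable
      = M , heavy-covering {w} (aM , M-max) covered
              (proj₂ (∃-heavy s (λ e → w e ∸ inc G u e) (∸-decreases (inc G u) w 1≤ ∑≤s)))
      where
      covered : ∀ M′ → Maximum w M′ → degᴹ G M′ u ≢ 0
      covered M′ (aM′ , M′-max) M′u = ¬u (M′ , aM′ , M′-max M aM , M′u)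
      1≤ : 1 ≤ ∑ (λ e → inc G u e ⊓ w e)
      1≤ = ≤-trans (covered⇒1≤wt {w} aM (covered M (aM , M-max))) (wt≤∑ M _)

-- Heavy perfect matchings in `r`-graphs.

module _ {G : Graph} {r : ℕ} (rG : IsRGraph r G) where

  ∑-inc≡r : ∀ v → ∑ (inc G v) ≡ r
  ∑-inc≡r v = trans (sym (sum-allFin (inc G v))) (proj₁ rG v)

  ∑-ends : (c : Fin (n G) → ℕ) → ∑ (λ e → c (src G e) + c (tgt G e)) ≡ r * ∑ c
  ∑-ends c = begin
    ∑ (λ e → c (src G e) + c (tgt G e))      ≡⟨ ∑-cong (λ e → sym (∑-inc G c e)) ⟩
    ∑ (λ e → ∑ (λ v → c v * inc G v e))      ≡⟨ ∑-comm _ ⟩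
    ∑ (λ v → ∑ (λ e → c v * inc G v e))      ≡⟨ ∑-cong (λ v → sym (*-∑ (c v) (inc G v))) ⟩
    ∑ (λ v → c v * ∑ (inc G v))              ≡⟨ ∑-cong (λ v → trans (cong (c v *_) (∑-inc≡r v)) (*-comm (c v) r)) ⟩
    ∑ (λ v → r * c v)                        ≡⟨ *-∑ r c ⟨
    r * ∑ c                                  ∎
    where open ≡-Reasoning

  -- The degrees over `K` sum to `2 * E` plus the size of the cut. If `K` has at most `2 * h`
  -- vertices this suffices; if it has `1 + 2 * h`, it is odd, and the at least `r` edges of its cut
  -- offset the degree of the extra vertex.
  rgraph⇒sparse : Sparse G r
  rgraph⇒sparse K h |K|≤ = *-cancelˡ-≤ 2 twice
    where
    S : Subset (n G)
    S = Vec.tabulate K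
    |S|≡ : ∣ S ∣ ≡ ∑ (ind ∘ K)
    |S|≡ = trans (∣∣≡∑ S) (∑-cong (λ v → cong ind (lookup∘tabulate K v)))
    E : ℕ
    E = ∑ (λ e → ind (K (src G e) ∧ K (tgt G e)))
    boundary≡ : boundary G S ≡ ∑ (λ e → ind (K (src G e) xor K (tgt G e)))
    boundary≡ = trans (sum-allFin (λ e → ind (lookup S (src G e) xor lookup S (tgt G e))))
      (∑-cong (λ e → cong₂ (λ a b → ind (a xor b)) (lookup∘tabulate K (src G e)) (lookup∘tabulate K (tgt G e))))
    counting : 2 * E + boundary G S ≡ r * ∑ (ind ∘ K)
    counting = begin
      2 * E + boundary G S
        ≡⟨ cong₂ _+_ (*-∑ 2 _) boundary≡ ⟩
      ∑ (λ e → 2 * ind (K (src G e) ∧ K (tgt G e))) + ∑ (λ e → ind (K (src G e) xor K (tgt G e)))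
        ≡⟨ ∑-+ _ _ ⟨
      ∑ (λ e → 2 * ind (K (src G e) ∧ K (tgt G e)) + ind (K (src G e) xor K (tgt G e)))
        ≡⟨ ∑-cong (λ e → both-or-one (K (src G e)) (K (tgt G e))) ⟩
      ∑ (λ e → ind (K (src G e)) + ind (K (tgt G e)))
        ≡⟨ ∑-ends (ind ∘ K) ⟩
      r * ∑ (ind ∘ K) ∎
      where
      open ≡-Reasoning
      both-or-one : ∀ a b → 2 * ind (a ∧ b) + ind (a xor b) ≡ ind a + ind b
      both-or-one false false = refl
      both-or-one false true  = refl
      both-or-one true  false = refl
      both-or-one true  true  = refl
    2rh : r * (2 * h) ≡ 2 * (r * h)
    2rh = swap₂ r h
      where
      swap₂ : ∀ r h → r * (2 * h) ≡ 2 * (r * h)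
      swap₂ = solve-∀
    open ≤-Reasoning
    twice : 2 * E ≤ 2 * (r * h)
    twice with m≤n⇒m<n∨m≡n |K|≤
    ... | inj₁ (s≤s |K|≤2h) = begin
      2 * E                ≤⟨ m≤m+n _ _ ⟩
      2 * E + boundary G S ≡⟨ counting ⟩
      r * ∑ (ind ∘ K)      ≤⟨ *-monoʳ-≤ r |K|≤2h ⟩
      r * (2 * h)          ≡⟨ 2rh ⟩
      2 * (r * h)          ∎
    ... | inj₂ |K|≡ = +-cancelʳ-≤ r _ _ (begin
      2 * E + r            ≤⟨ +-monoʳ-≤ (2 * E) (proj₂ rG S odd) ⟩
      2 * E + boundary G S ≡⟨ counting ⟩
      r * ∑ (ind ∘ K)      ≡⟨ cong (r *_) |K|≡ ⟩
      r * (1 + 2 * h)      ≡⟨ *-suc r (2 * h) ⟩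
      r + r * (2 * h)      ≡⟨ trans (+-comm r _) (cong (_+ r) 2rh) ⟩
      2 * (r * h) + r      ∎)
      where
      odd : ∣ S ∣ % 2 ≡ 1
      odd = trans (cong (_% 2) (trans |S|≡ (trans |K|≡ (cong suc (*-comm 2 h))))) ([m+kn]%n≡m%n 1 h 2)

  2m≡rn : m G * 2 ≡ r * n G
  2m≡rn = begin
    m G * 2                ≡⟨ ∑-const (m G) 2 ⟨
    ∑ {m G} (λ _ → 2)      ≡⟨ ∑-ends (λ _ → 1) ⟩
    r * ∑ {n G} (λ _ → 1)  ≡⟨ cong (r *_) (trans (∑-const (n G) 1) (*-identityʳ (n G))) ⟩
    r * n G                ∎
    where open ≡-Reasoning

  ∑-degᴹ : (M : Subset (m G)) → ∑ (degᴹ G M) ≡ 2 * size G M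
  ∑-degᴹ M = begin
    ∑ (degᴹ G M)              ≡⟨ ∑-cong (λ v → sym (*-identityˡ _)) ⟩
    ∑ (λ v → 1 * degᴹ G M v)  ≡⟨ handshake G M (λ _ → 1) ⟩
    wt M (λ _ → 2)            ≡⟨ wt-*ʳ M 2 ⟩
    2 * size G M              ∎
    where open ≡-Reasoning

  matching⇒perfect : ∀ {M} → Matching G M → n G ≤ 2 * size G M → IsPerfectMatching G M
  matching⇒perfect {M} mM n≤ v = begin
    degIn G M v     ≡⟨ sum-allFin _ ⟩
    ∑ (λ e → if lookup M e then inc G v e else 0) ≡⟨ ∑-cong (λ e → ind-* (lookup M e) (inc G v e)) ⟩
    ∑ (λ e → ind (lookup M e) * inc G v e)        ≡⟨ wt-≡ M (inc G v) ⟨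
    degᴹ G M v      ≡⟨ ≤-antisym (mM v) (m∸n≡0⇒m≤n (∑-≡0⇒≡0 missed v)) ⟩
    1               ∎
    where
    open ≡-Reasoning
    missed : ∑ (λ v → 1 ∸ degᴹ G M v) ≡ 0
    missed = n≤0⇒n≡0 (+-cancelʳ-≤ (2 * size G M) _ 0 (≤-trans (≤-reflexive (begin
      ∑ (λ v → 1 ∸ degᴹ G M v) + 2 * size G M      ≡⟨ cong (∑ (λ v → 1 ∸ degᴹ G M v) +_) (∑-degᴹ M) ⟨
      ∑ (λ v → 1 ∸ degᴹ G M v) + ∑ (degᴹ G M)      ≡⟨ ∑-+ _ _ ⟨
      ∑ (λ v → 1 ∸ degᴹ G M v + degᴹ G M v)        ≡⟨ ∑-cong (λ v → m∸n+n≡m (mM v)) ⟩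
      ∑ {n G} (λ _ → 1)                            ≡⟨ trans (∑-const (n G) 1) (*-identityʳ (n G)) ⟩
      n G                                          ∎)) n≤))

  -- The constant L outweighs w, so that a heavy matching for w + L has maximum size.
  ∃-perfect-heavy : 1 ≤ r → (w : Fin (m G) → ℕ) → ∃ λ M → IsPerfectMatching G M × ∑ w ≤ r * wt M w
  ∃-perfect-heavy 1≤r w
    with M , (mM , _) , heavy ← ∃-heavy G {r} (λ v → ≤-reflexive (∑-inc≡r v)) rgraph⇒sparse
                                 _ (λ e → w e + suc (2 * ∑ w)) ≤-refl
    = M , matching⇒perfect mM n≤2a , *-cancelˡ-≤ 2 2W≤2rb
    where
    open ≤-Reasoning
    W = ∑ w
    -- Since `b ≤ W`, this exceeds `2 * b`: if `M` missed a vertex, `2 * (r * b)` would have to make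
    -- up a deficit of `r * L` in `doubled`.
    L = suc (2 * W)
    a = size G M
    b = wt M w
    heavy′ : W + m G * L ≤ r * (b + L * a)
    heavy′ = subst₂ _≤_ (trans (∑-+ w (λ _ → L)) (cong (W +_) (∑-const (m G) L)))
                        (cong (r *_) (trans (wt-+ M w (λ _ → L)) (cong (b +_) (wt-*ʳ M L)))) heavy
    -- Doubling turns `m G` into `r * n G`, so that `n G` can be compared with `2 * a`.
    doubled : 2 * W + r * n G * L ≤ 2 * (r * b) + r * (2 * a) * L
    doubled = begin
      2 * W + r * n G * L          ≡⟨ cong (λ x → 2 * W + x * L) 2m≡rn ⟨
      2 * W + m G * 2 * L          ≡⟨ factor W (m G) L ⟩
      2 * (W + m G * L)            ≤⟨ *-monoʳ-≤ 2 heavy′ ⟩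
      2 * (r * (b + L * a))        ≡⟨ expand r b L a ⟩
      2 * (r * b) + r * (2 * a) * L ∎
      where
      factor : ∀ W m L → 2 * W + m * 2 * L ≡ 2 * (W + m * L)
      factor = solve-∀
      expand : ∀ r b L a → 2 * (r * (b + L * a)) ≡ 2 * (r * b) + r * (2 * a) * L
      expand = solve-∀
    2a≤n : 2 * a ≤ n G
    2a≤n = begin
      2 * a             ≡⟨ ∑-degᴹ M ⟨
      ∑ (degᴹ G M)      ≤⟨ ∑-mono mM ⟩
      ∑ {n G} (λ _ → 1) ≡⟨ trans (∑-const (n G) 1) (*-identityʳ (n G)) ⟩
      n G               ∎
    2W≤2rb : 2 * W ≤ 2 * (r * b)
    2W≤2rb = +-cancelʳ-≤ (r * n G * L) _ _ (≤-trans doubled (+-monoʳ-≤ _ (*-monoˡ-≤ L (*-monoʳ-≤ r 2a≤n))))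
    n≤2a : n G ≤ 2 * a
    n≤2a = ≮⇒≥ λ 2a<n → <⇒≱ (*-monoʳ-< r {{>-nonZero 1≤r}} (s≤s (*-monoʳ-≤ 2 (wt≤∑ M w))))
      (+-cancelʳ-≤ (r * (2 * a) * L) _ _ (begin
        r * L + r * (2 * a) * L        ≡⟨ collect r a L ⟩
        r * suc (2 * a) * L            ≤⟨ *-monoˡ-≤ L (*-monoʳ-≤ r 2a<n) ⟩
        r * n G * L                    ≤⟨ m≤n+m _ (2 * W) ⟩
        2 * W + r * n G * L            ≤⟨ doubled ⟩
        2 * (r * b) + r * (2 * a) * L  ≡⟨ cong (_+ r * (2 * a) * L) (swap₂ r b) ⟩
        r * (2 * b) + r * (2 * a) * L  ∎))
      where
      collect : ∀ r a L → r * L + r * (2 * a) * L ≡ r * suc (2 * a) * L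
      collect = solve-∀
      swap₂ : ∀ r b → 2 * (r * b) ≡ r * (2 * b)
      swap₂ = solve-∀

-- Greedy choice of the `k` matchings.

covered : ∀ {k} → (Fin k → Subset p) → Fin p → Bool
covered {k = k} Ms e = any (λ i → lookup (Ms i) e) (allFin k)

covered-∷ : ∀ {k} (M : Subset p) (Ms : Fin k → Subset p) e →
            covered (M ∷ᶠ Ms) e ≡ lookup M e ∨ covered Ms e
covered-∷ M Ms e = cong (λ bs → lookup M e ∨ or bs)
  (trans (map-tabulate suc (λ i → lookup ((M ∷ᶠ Ms) i) e)) (sym (map-tabulate id (λ i → lookup (Ms i) e))))

uncovered : ∀ {k} → (Fin k → Subset p) → Fin p → ℕ
uncovered Ms e = ind (not (covered Ms e))

uncovered-∷ : ∀ {k} (M : Subset p) (Ms : Fin k → Subset p) →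
              ∑ (uncovered Ms) ≡ wt M (uncovered Ms) + ∑ (uncovered (M ∷ᶠ Ms))
uncovered-∷ M Ms = begin
  ∑ (uncovered Ms)
    ≡⟨ ∑-cong (λ e → trans (split (lookup M e) (covered Ms e)) (cong (λ b → ind (lookup M e) * uncovered Ms e + ind (not b)) (sym (covered-∷ M Ms e)))) ⟩
  ∑ (λ e → ind (lookup M e) * uncovered Ms e + uncovered (M ∷ᶠ Ms) e)
    ≡⟨ ∑-+ _ _ ⟩
  ∑ (λ e → ind (lookup M e) * uncovered Ms e) + ∑ (uncovered (M ∷ᶠ Ms))
    ≡⟨ cong (_+ ∑ (uncovered (M ∷ᶠ Ms))) (wt-≡ M (uncovered Ms)) ⟨
  wt M (uncovered Ms) + ∑ (uncovered (M ∷ᶠ Ms)) ∎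
  where
  open ≡-Reasoning
  split : ∀ b c → ind (not c) ≡ ind b * ind (not c) + ind (not (b ∨ c))
  split true  c = sym (trans (+-identityʳ _) (+-identityʳ _))
  split false c = refl

unionSize+uncovered : (G : Graph) → ∀ {k} (Ms : Fin k → Subset (m G)) → ∑ (uncovered Ms) + unionSize G Ms ≡ m G
unionSize+uncovered G Ms = begin
  ∑ (uncovered Ms) + unionSize G Ms               ≡⟨ cong (∑ (uncovered Ms) +_) (sum-allFin (ind ∘ covered Ms)) ⟩
  ∑ (uncovered Ms) + ∑ (ind ∘ covered Ms)         ≡⟨ ∑-+ _ _ ⟨
  ∑ (λ e → uncovered Ms e + ind (covered Ms e))   ≡⟨ ∑-cong (λ e → complement (covered Ms e)) ⟩
  ∑ {m G} (λ _ → 1)                               ≡⟨ trans (∑-const (m G) 1) (*-identityʳ (m G)) ⟩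
  m G                                             ∎
  where
  open ≡-Reasoning
  complement : ∀ b → ind (not b) + ind b ≡ 1
  complement true  = refl
  complement false = refl

-- `u` and `u′` count the uncovered edges before and after a matching that newly covers `x` of them;
-- `suc d` is `r`, and `a`, `b` stand for `r ^ k` and `(r - 1) ^ k * m G`. From `u ≤ r * x` follows
-- `r * u′ ≤ (r - 1) * u`.
greedy-step : ∀ {d a b u u′ x} → u ≤ suc d * x → u ≡ x + u′ → a * u ≤ b → suc d * a * u′ ≤ d * b
greedy-step {d} {a} {b} {u} {u′} {x} u≤rx u≡x+u′ au≤b = begin
  suc d * a * u′     ≡⟨ rotate (suc d) a u′ ⟩
  a * (suc d * u′)   ≤⟨ *-monoʳ-≤ a shrink ⟩
  a * (d * u)        ≡⟨ swap₂ a d u ⟩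
  d * (a * u)        ≤⟨ *-monoʳ-≤ d au≤b ⟩
  d * b              ∎
  where
  open ≤-Reasoning
  rotate : ∀ a b c → a * b * c ≡ b * (a * c)
  rotate = solve-∀
  swap₂ : ∀ a b c → a * (b * c) ≡ b * (a * c)
  swap₂ = solve-∀
  shrink : suc d * u′ ≤ d * u
  shrink = +-cancelˡ-≤ u _ _ (begin
    u + suc d * u′            ≤⟨ +-monoˡ-≤ (suc d * u′) u≤rx ⟩
    suc d * x + suc d * u′    ≡⟨ *-distribˡ-+ (suc d) x u′ ⟨
    suc d * (x + u′)          ≡⟨ cong (suc d *_) u≡x+u′ ⟨
    suc d * u                 ∎)

-- With the 0-1 weight `uncovered Ms`, a heavy perfect matching covers at least a fraction `1 / r`
-- of what is still uncovered. Writing `r` as `suc d` avoids subtraction.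
greedy : ∀ {G d} → IsRGraph (suc d) G → ∀ k →
         ∃ λ (Ms : Fin k → Subset (m G)) → (∀ i → IsPerfectMatching G (Ms i)) ×
         suc d ^ k * ∑ (uncovered Ms) ≤ d ^ k * m G
greedy {G} rG zero = (λ ()) , (λ ()) , ≤-reflexive (cong (_+ 0) (trans (∑-const (m G) 1) (*-identityʳ (m G))))
greedy {G} {d} rG (suc k) =
  let Ms , perfect , bound = greedy rG k
      M , perfectM , heavy = ∃-perfect-heavy rG (s≤s z≤n) (uncovered Ms)
  in M ∷ᶠ Ms , ∀-cons perfectM perfect ,
     subst (suc d * suc d ^ k * ∑ (uncovered (M ∷ᶠ Ms)) ≤_) (sym (*-assoc d (d ^ k) (m G)))
       (greedy-step {d} {suc d ^ k} heavy (uncovered-∷ M Ms) bound)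

-- A lower bound for the infimum asks for `k` suitable matchings in every `r`-graph; the inequality
-- is cleared of its denominators `r ^ k` and `m G`.
theorem3p2 : (r k : ℕ) → 3 ≤ r → 1 ≤ k → (G : Graph) → IsRGraph r G →
    Σ (Fin k → Subset (m G)) λ Ms →
    ((i : Fin k) → IsPerfectMatching G (Ms i)) ×
    ((r ^ k ∸ (r ∸ 1) ^ k) * m G ≤ r ^ k * unionSize G Ms)
theorem3p2 r@(suc _) k 3≤r 1≤k G rG
  with Ms , perfect , bound ← greedy rG k
  = Ms , perfect , (begin
    (r ^ k ∸ (r ∸ 1) ^ k) * m G
      ≡⟨ *-distribʳ-∸ (m G) (r ^ k) ((r ∸ 1) ^ k) ⟩
    r ^ k * m G ∸ (r ∸ 1) ^ k * m G
      ≡⟨ cong (λ x → r ^ k * x ∸ (r ∸ 1) ^ k * m G) (unionSize+uncovered G Ms) ⟨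
    r ^ k * (∑ (uncovered Ms) + unionSize G Ms) ∸ (r ∸ 1) ^ k * m G
      ≡⟨ cong (_∸ (r ∸ 1) ^ k * m G) (*-distribˡ-+ (r ^ k) (∑ (uncovered Ms)) (unionSize G Ms)) ⟩
    r ^ k * ∑ (uncovered Ms) + r ^ k * unionSize G Ms ∸ (r ∸ 1) ^ k * m G
      -- By `bound` the uncovered term is at most what the truncated subtraction removes.
      ≤⟨ m≤n+o⇒m∸n≤o _ _ (+-monoˡ-≤ (r ^ k * unionSize G Ms) bound) ⟩
    r ^ k * unionSize G Ms ∎)
  where open ≤-Reasoning
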